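{- Let $\mathsf{CLL}_{\rm b}:=\mathsf{ILL}_\bot+\mathsf{DNE}$ and let $A\mapsto A^{\ddagger}$ be the translation of formulas of classical linear logic $\mathsf{CLL}$ into formulas of $\mathsf{ILL}_\bot$ defined in the context. Then for every formula $A$ of $\mathsf{CLL}$: $\vdash_{\mathsf{CLL}}A$ if and only if $\vdash_{\mathsf{CLL}_{\rm b}}A^{\ddagger}$.
   Context: Intuitionistic linear logic $\mathsf{ILL}$ (first order). Formulas are built from atomic formulas, including the constants $1,\top,0$, using $\otimes,\&,\oplus,\multimap$, $\forall x,\exists x$ and $!$. Sequents are $\Gamma\vdash A$ with $\Gamma$ a finite multiset of formulas and exactly one formula on the right. Axioms: $A\vdash A$; $\vdash 1$; $\Gamma\vdash\top$; $\Gamma,0\vdash C$. Rules (premises $\Rightarrow$ conclusion): (cut) $\Gamma\vdash A;\ \Delta,A\vdash C\Rightarrow\Gamma,\Delta\vdash C$; $\Gamma\vdash C\Rightarrow\Gamma,1\vdash C$; $\Gamma\vdash A;\ \Delta\vdash B\Rightarrow\Gamma,\Delta\vdash A\otimes B$; $\Gamma,A,B\vdash C\Rightarrow\Gamma,A\otimes B\vdash C$; $\Gamma,A\vdash B\Rightarrow\Gamma\vdash A\multimap B$; $\Gamma\vdash A;\ \Delta,B\vdash C\Rightarrow\Gamma,\Delta,A\multimap B\vdash C$; $\Gamma\vdash A;\ \Gamma\vdash B\Rightarrow\Gamma\vdash A\& B$; $\Gamma,A\vdash C\Rightarrow\Gamma,A\& B\vdash C$; $\Gamma,B\vdash C\Rightarrow\Gamma,A\&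 B\vdash C$; $\Gamma\vdash A\Rightarrow\Gamma\vdash A\oplus B$; $\Gamma\vdash B\Rightarrow\Gamma\vdash A\oplus B$; $\Gamma,A\vdash C;\ \Gamma,B\vdash C\Rightarrow\Gamma,A\oplus B\vdash C$; $\Gamma\vdash A\Rightarrow\Gamma\vdash\forall xA$; $\Gamma,A[t/x]\vdash C\Rightarrow\Gamma,\forall xA\vdash C$; $\Gamma\vdash A[t/x]\Rightarrow\Gamma\vdash\exists xA$; $\Gamma,A\vdash C\Rightarrow\Gamma,\exists xA\vdash C$ (usual eigenvariable conditions); $\Gamma,!A,!A\vdash C\Rightarrow\Gamma,!A\vdash C$; $\Gamma\vdash C\Rightarrow\Gamma,!A\vdash C$; $!\Gamma\vdash A\Rightarrow\,!\Gamma\vdash\,!A$; $\Gamma,A\vdash C\Rightarrow\Gamma,!A\vdash C$. $\mathsf{ILL}_\bot$ extends $\mathsf{ILL}$ by one more constant $\bot$ (also counted as atomic); its sequents have at most one formula on the right (so $C$ in the rules above may be absent), and it has the additional axiom $\bot\vdash$ and rule $\Gamma\vdash\ \Rightarrow\Gamma\vdash\bot$. Negation is $\neg A:=A\multimap\bot$. $\mathsf{DNE}$ is the axiom schema $\neg\neg A\vdash A$. $\vdash_S A$ means that the sequent $\vdash A$ is derivable in $S$. $\mathsf{CLL}$ is standard first-order classical linear logic, in the language with atomic formulas (including the constants), $\otimes,\&,\oplus,\multimap$, the multiplicative disjunction ("par") written here $\wp$, the exponentials $!,?$, and $\forall,\exists$. The translation $(\cdot)^\ddagger$: $P^\ddagger:=P$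 ($P$ atomic); $(A\otimes B)^\ddagger:=A^\ddagger\otimes B^\ddagger$; $(A\& B)^\ddagger:=A^\ddagger\& B^\ddagger$; $(A\oplus B)^\ddagger:=A^\ddagger\oplus B^\ddagger$; $(A\multimap B)^\ddagger:=A^\ddagger\multimap B^\ddagger$; $(A\,\wp\,B)^\ddagger:=\neg(\neg A^\ddagger\otimes\neg B^\ddagger)$; $(\forall xA)^\ddagger:=\forall xA^\ddagger$; $(\exists xA)^\ddagger:=\exists xA^\ddagger$; $(!A)^\ddagger:=\,!A^\ddagger$; $(?A)^\ddagger:=\neg\,!\,\neg A^\ddagger$. -}

module Defs where

open import Data.List.Base using (List; []; _∷_; _++_; map)
open import Data.List.Relation.Binary.Permutation.Propositional using (_↭_)
open import Data.Maybe.Base as Maybe using (Maybe; just; nothing)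
open import Data.Nat.Base using (ℕ; zero; suc)
open import Data.Vec.Base using (Vec; []; _∷_)

record Signature : Set₁ where
  field
    Function  : Set
    arity     : Function → ℕ
    Predicate : Set
    arityᵖ    : Predicate → ℕ

data Language : Set where
  intuitionistic classical : Language

module LinearLogic (S : Signature) where
  open Signature S

  -- Variables are unscoped de Bruijn indices, so that infinitely many free
  -- variables are always available, even when the signature has no constants.
  data Term : Set where
    var : ℕ → Term
    fun : (f : Function) → Vec Term (arity f) → Term

  infix  9 !_ ⁇_ ∀∙_ ∃∙_ ¬_
  infixr 8 _⊗_ _&_
  infixr 7 _⊕_ _⅋_
  infixr 6 _⊸_

  -- The language of ILL⊥ is that of CLL without par and why-not.
  data Formula : Language → Set where
    atom        : ∀ {ℓ} (P : Predicate) → Vec Term (arityᵖ P) → Formula ℓ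
    𝟏 ⊤ 𝟎 ⊥     : ∀ {ℓ} → Formula ℓ
    _⊗_ _&_ _⊕_ : ∀ {ℓ} → Formula ℓ → Formula ℓ → Formula ℓ
    _⊸_         : ∀ {ℓ} → Formula ℓ → Formula ℓ → Formula ℓ
    _⅋_         : Formula classical → Formula classical → Formula classical
    ∀∙_ ∃∙_     : ∀ {ℓ} → Formula ℓ → Formula ℓ
    !_          : ∀ {ℓ} → Formula ℓ → Formula ℓ
    ⁇_          : Formula classical → Formula classical

  ¬_ : ∀ {ℓ} → Formula ℓ → Formula ℓ
  ¬ A = A ⊸ ⊥

  Subst : Set
  Subst = ℕ → Term

  mutual
    subᵗ : Subst → Term → Term
    subᵗ σ (var x)    = σ x
    subᵗ σ (fun f ts) = fun f (subᵗˢ σ ts)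

    subᵗˢ : ∀ {n} → Subst → Vec Term n → Vec Term n
    subᵗˢ σ []       = []
    subᵗˢ σ (t ∷ ts) = subᵗ σ t ∷ subᵗˢ σ ts

  shift : Subst
  shift x = var (suc x)

  lift : Subst → Subst
  lift σ zero    = var zero
  lift σ (suc x) = subᵗ shift (σ x)

  sub : ∀ {ℓ} → Subst → Formula ℓ → Formula ℓ
  sub σ (atom P ts) = atom P (subᵗˢ σ ts)
  sub σ 𝟏           = 𝟏
  sub σ ⊤           = ⊤
  sub σ 𝟎           = 𝟎
  sub σ ⊥           = ⊥
  sub σ (A ⊗ B)     = sub σ A ⊗ sub σ B
  sub σ (A & B)     = sub σ A & sub σ B
  sub σ (A ⊕ B)     = sub σ A ⊕ sub σ B
  sub σ (A ⊸ B)     = sub σ A ⊸ sub σ B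
  sub σ (A ⅋ B)     = sub σ A ⅋ sub σ B
  sub σ (∀∙ A)      = ∀∙ sub (lift σ) A
  sub σ (∃∙ A)      = ∃∙ sub (lift σ) A
  sub σ (! A)       = ! sub σ A
  sub σ (⁇ A)       = ⁇ sub σ A

  instantiate : Term → Subst
  instantiate t zero    = t
  instantiate t (suc x) = var x

  infix 10 _[_] _↑

  _[_] : ∀ {ℓ} → Formula ℓ → Term → Formula ℓ
  A [ t ] = sub (instantiate t) A

  -- In a premise whose side formulas are all shifted by _↑, the variable 0
  -- is an eigenvariable.
  _↑ : ∀ {ℓ} → Formula ℓ → Formula ℓ
  A ↑ = sub shift A

  -- A schema is the set of sequents that are its instances.
  AxiomSchema : Set₁
  AxiomSchema = List (Formula intuitionistic) → Maybe (Formula intuitionistic) → Set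

  module _ where
    private variable
      A B : Formula intuitionistic
      C   : Maybe (Formula intuitionistic)
      Γ Δ : List (Formula intuitionistic)
      t   : Term

    -- Multisets are lists, with the exchange rule for ↭; `nothing` is the
    -- empty right-hand side.
    infix 3 ILL⊥+_∶_⊢_
    data ILL⊥+_∶_⊢_ (Ax : AxiomSchema) :
         List (Formula intuitionistic) → Maybe (Formula intuitionistic) → Set where
      axiom    : Ax Γ C → ILL⊥+ Ax ∶ Γ ⊢ C
      exchange : Γ ↭ Δ → ILL⊥+ Ax ∶ Γ ⊢ C → ILL⊥+ Ax ∶ Δ ⊢ C
      id       : ILL⊥+ Ax ∶ A ∷ [] ⊢ just A
      cut      : ILL⊥+ Ax ∶ Γ ⊢ just A → ILL⊥+ Ax ∶ A ∷ Δ ⊢ C → ILL⊥+ Ax ∶ Γ ++ Δ ⊢ C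
      𝟏R       : ILL⊥+ Ax ∶ [] ⊢ just 𝟏
      𝟏L       : ILL⊥+ Ax ∶ Γ ⊢ C → ILL⊥+ Ax ∶ 𝟏 ∷ Γ ⊢ C
      ⊤R       : ILL⊥+ Ax ∶ Γ ⊢ just ⊤
      𝟎L       : ILL⊥+ Ax ∶ 𝟎 ∷ Γ ⊢ C
      ⊥L       : ILL⊥+ Ax ∶ ⊥ ∷ [] ⊢ nothing
      ⊥R       : ILL⊥+ Ax ∶ Γ ⊢ nothing → ILL⊥+ Ax ∶ Γ ⊢ just ⊥
      ⊗R       : ILL⊥+ Ax ∶ Γ ⊢ just A → ILL⊥+ Ax ∶ Δ ⊢ just B →
                 ILL⊥+ Ax ∶ Γ ++ Δ ⊢ just (A ⊗ B)
      ⊗L       : ILL⊥+ Ax ∶ A ∷ B ∷ Γ ⊢ C → ILL⊥+ Ax ∶ A ⊗ B ∷ Γ ⊢ C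
      ⊸R       : ILL⊥+ Ax ∶ A ∷ Γ ⊢ just B → ILL⊥+ Ax ∶ Γ ⊢ just (A ⊸ B)
      ⊸L       : ILL⊥+ Ax ∶ Γ ⊢ just A → ILL⊥+ Ax ∶ B ∷ Δ ⊢ C →
                 ILL⊥+ Ax ∶ A ⊸ B ∷ Γ ++ Δ ⊢ C
      &R       : ILL⊥+ Ax ∶ Γ ⊢ just A → ILL⊥+ Ax ∶ Γ ⊢ just B →
                 ILL⊥+ Ax ∶ Γ ⊢ just (A & B)
      &L₁      : ILL⊥+ Ax ∶ A ∷ Γ ⊢ C → ILL⊥+ Ax ∶ A & B ∷ Γ ⊢ C
      &L₂      : ILL⊥+ Ax ∶ B ∷ Γ ⊢ C → ILL⊥+ Ax ∶ A & B ∷ Γ ⊢ C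
      ⊕R₁      : ILL⊥+ Ax ∶ Γ ⊢ just A → ILL⊥+ Ax ∶ Γ ⊢ just (A ⊕ B)
      ⊕R₂      : ILL⊥+ Ax ∶ Γ ⊢ just B → ILL⊥+ Ax ∶ Γ ⊢ just (A ⊕ B)
      ⊕L       : ILL⊥+ Ax ∶ A ∷ Γ ⊢ C → ILL⊥+ Ax ∶ B ∷ Γ ⊢ C → ILL⊥+ Ax ∶ A ⊕ B ∷ Γ ⊢ C
      ∀R       : ILL⊥+ Ax ∶ map _↑ Γ ⊢ just A → ILL⊥+ Ax ∶ Γ ⊢ just (∀∙ A)
      ∀L       : ILL⊥+ Ax ∶ A [ t ] ∷ Γ ⊢ C → ILL⊥+ Ax ∶ ∀∙ A ∷ Γ ⊢ C
      ∃R       : ILL⊥+ Ax ∶ Γ ⊢ just (A [ t ]) → ILL⊥+ Ax ∶ Γ ⊢ just (∃∙ A)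
      ∃L       : ILL⊥+ Ax ∶ A ∷ map _↑ Γ ⊢ Maybe.map _↑ C → ILL⊥+ Ax ∶ ∃∙ A ∷ Γ ⊢ C
      !C       : ILL⊥+ Ax ∶ ! A ∷ ! A ∷ Γ ⊢ C → ILL⊥+ Ax ∶ ! A ∷ Γ ⊢ C
      !W       : ILL⊥+ Ax ∶ Γ ⊢ C → ILL⊥+ Ax ∶ ! A ∷ Γ ⊢ C
      !R       : ILL⊥+ Ax ∶ map !_ Γ ⊢ just A → ILL⊥+ Ax ∶ map !_ Γ ⊢ just (! A)
      !L       : ILL⊥+ Ax ∶ A ∷ Γ ⊢ C → ILL⊥+ Ax ∶ ! A ∷ Γ ⊢ C

    data DNE : AxiomSchema where
      dne : DNE (¬ ¬ A ∷ []) (just A)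

  infix 3 CLLb_⊢_
  CLLb_⊢_ : List (Formula intuitionistic) → Maybe (Formula intuitionistic) → Set
  CLLb Γ ⊢ C = ILL⊥+ DNE ∶ Γ ⊢ C

  module _ where
    private variable
      A B         : Formula classical
      Γ Γ′ Δ Δ′   : List (Formula classical)
      t           : Term

    infix 3 CLL_⊢_
    data CLL_⊢_ : List (Formula classical) → List (Formula classical) → Set where
      exchange : Γ ↭ Γ′ → Δ ↭ Δ′ → CLL Γ ⊢ Δ → CLL Γ′ ⊢ Δ′
      id       : CLL A ∷ [] ⊢ A ∷ []
      cut      : CLL Γ ⊢ A ∷ Δ → CLL A ∷ Γ′ ⊢ Δ′ → CLL Γ ++ Γ′ ⊢ Δ ++ Δ′
      𝟏R       : CLL [] ⊢ 𝟏 ∷ []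
      𝟏L       : CLL Γ ⊢ Δ → CLL 𝟏 ∷ Γ ⊢ Δ
      ⊤R       : CLL Γ ⊢ ⊤ ∷ Δ
      𝟎L       : CLL 𝟎 ∷ Γ ⊢ Δ
      ⊥L       : CLL ⊥ ∷ [] ⊢ []
      ⊥R       : CLL Γ ⊢ Δ → CLL Γ ⊢ ⊥ ∷ Δ
      ⊗R       : CLL Γ ⊢ A ∷ Δ → CLL Γ′ ⊢ B ∷ Δ′ → CLL Γ ++ Γ′ ⊢ A ⊗ B ∷ Δ ++ Δ′
      ⊗L       : CLL A ∷ B ∷ Γ ⊢ Δ → CLL A ⊗ B ∷ Γ ⊢ Δ
      ⅋R       : CLL Γ ⊢ A ∷ B ∷ Δ → CLL Γ ⊢ A ⅋ B ∷ Δ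
      ⅋L       : CLL A ∷ Γ ⊢ Δ → CLL B ∷ Γ′ ⊢ Δ′ → CLL A ⅋ B ∷ Γ ++ Γ′ ⊢ Δ ++ Δ′
      ⊸R       : CLL A ∷ Γ ⊢ B ∷ Δ → CLL Γ ⊢ A ⊸ B ∷ Δ
      ⊸L       : CLL Γ ⊢ A ∷ Δ → CLL B ∷ Γ′ ⊢ Δ′ → CLL A ⊸ B ∷ Γ ++ Γ′ ⊢ Δ ++ Δ′
      &R       : CLL Γ ⊢ A ∷ Δ → CLL Γ ⊢ B ∷ Δ → CLL Γ ⊢ A & B ∷ Δ
      &L₁      : CLL A ∷ Γ ⊢ Δ → CLL A & B ∷ Γ ⊢ Δ
      &L₂      : CLL B ∷ Γ ⊢ Δ → CLL A & B ∷ Γ ⊢ Δ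
      ⊕R₁      : CLL Γ ⊢ A ∷ Δ → CLL Γ ⊢ A ⊕ B ∷ Δ
      ⊕R₂      : CLL Γ ⊢ B ∷ Δ → CLL Γ ⊢ A ⊕ B ∷ Δ
      ⊕L       : CLL A ∷ Γ ⊢ Δ → CLL B ∷ Γ ⊢ Δ → CLL A ⊕ B ∷ Γ ⊢ Δ
      ∀R       : CLL map _↑ Γ ⊢ A ∷ map _↑ Δ → CLL Γ ⊢ ∀∙ A ∷ Δ
      ∀L       : CLL A [ t ] ∷ Γ ⊢ Δ → CLL ∀∙ A ∷ Γ ⊢ Δ
      ∃R       : CLL Γ ⊢ A [ t ] ∷ Δ → CLL Γ ⊢ ∃∙ A ∷ Δ
      ∃L       : CLL A ∷ map _↑ Γ ⊢ map _↑ Δ → CLL ∃∙ A ∷ Γ ⊢ Δ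
      !C       : CLL ! A ∷ ! A ∷ Γ ⊢ Δ → CLL ! A ∷ Γ ⊢ Δ
      !W       : CLL Γ ⊢ Δ → CLL ! A ∷ Γ ⊢ Δ
      !R       : CLL map !_ Γ ⊢ A ∷ map ⁇_ Δ → CLL map !_ Γ ⊢ ! A ∷ map ⁇_ Δ
      !L       : CLL A ∷ Γ ⊢ Δ → CLL ! A ∷ Γ ⊢ Δ
      ⁇C       : CLL Γ ⊢ ⁇ A ∷ ⁇ A ∷ Δ → CLL Γ ⊢ ⁇ A ∷ Δ
      ⁇W       : CLL Γ ⊢ Δ → CLL Γ ⊢ ⁇ A ∷ Δ
      ⁇R       : CLL Γ ⊢ A ∷ Δ → CLL Γ ⊢ ⁇ A ∷ Δ
      ⁇L       : CLL A ∷ map !_ Γ ⊢ map ⁇_ Δ → CLL ⁇ A ∷ map !_ Γ ⊢ map ⁇_ Δ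

  infix 2 ⊢CLL_ ⊢CLLb_

  ⊢CLL_ : Formula classical → Set
  ⊢CLL A = CLL [] ⊢ A ∷ []

  ⊢CLLb_ : Formula intuitionistic → Set
  ⊢CLLb A = CLLb [] ⊢ just A

  infix 10 _‡

  _‡ : Formula classical → Formula intuitionistic
  atom P ts ‡ = atom P ts
  𝟏 ‡         = 𝟏
  ⊤ ‡         = ⊤
  𝟎 ‡         = 𝟎
  ⊥ ‡         = ⊥
  (A ⊗ B) ‡   = A ‡ ⊗ B ‡
  (A & B) ‡   = A ‡ & B ‡
  (A ⊕ B) ‡   = A ‡ ⊕ B ‡
  (A ⊸ B) ‡   = A ‡ ⊸ B ‡
  (A ⅋ B) ‡   = ¬ (¬ A ‡ ⊗ ¬ B ‡)
  (∀∙ A) ‡    = ∀∙ A ‡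
  (∃∙ A) ‡    = ∃∙ A ‡
  (! A) ‡     = ! A ‡
  (⁇ A) ‡     = ¬ ! ¬ A ‡

{-# OPTIONS --safe #-}
-- Two-sided classical sequents are read intuitionistically by negating the
-- succedents: Γ ⊢ Δ becomes Γ‡ , ¬Δ‡ ⊢, and DNE moves a formula ¬A‡ back to
-- the right as A‡. Conversely ILL⊥ embeds into CLL, where DNE is
-- derivable, and there A‡ is provably equivalent to A.
module Submission where

open import Algebra.Bundles using (CommutativeMonoid)
import Algebra.Properties.CommutativeSemigroup as CommutativeSemigroupProperties
open import Data.List.Base using (List; []; _∷_; _++_; map; fromMaybe)
open import Data.List.Properties using (map-++; map-∘; map-cong)
open import Data.List.Relation.Binary.Permutation.Propositional
  using (_↭_; refl; prep; swap; ↭-sym; ↭-trans; ↭-reflexive)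
import Data.List.Relation.Binary.Permutation.Propositional.Properties as ↭
open import Data.Maybe.Base as Maybe using (Maybe; just; nothing)
open import Data.Nat.Base using (zero; suc)
open import Data.Vec.Base using (Vec; []; _∷_)
open import Defs
open import Function.Base using (_∘_)
open import Function.Bundles using (_⇔_; mk⇔)
open import Relation.Binary.PropositionalEquality
  using (_≡_; refl; sym; trans; cong; cong₂; subst)

++-interchange : ∀ {a} {A : Set a} (ws xs ys zs : List A) →
  (ws ++ xs) ++ (ys ++ zs) ↭ (ws ++ ys) ++ (xs ++ zs)
++-interchange = CommutativeSemigroupProperties.interchange
  (CommutativeMonoid.commutativeSemigroup ↭.++-commutativeMonoid)

map-square : ∀ {a b c d} {A : Set a} {B : Set b} {C : Set c} {D : Set d}
  {f : B → D} {g : A → B} {h : C → D} {k : A → C} →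
  (∀ x → f (g x) ≡ h (k x)) → ∀ xs → map f (map g xs) ≡ map h (map k xs)
map-square eq xs = trans (sym (map-∘ xs)) (trans (map-cong eq xs) (map-∘ xs))

module Translation (S : Signature) where
  open LinearLogic S

  -- Substitution

  mutual
    subᵗ-∘ : ∀ {σ τ ρ : Subst} → (∀ x → subᵗ τ (σ x) ≡ ρ x) →
      ∀ t → subᵗ τ (subᵗ σ t) ≡ subᵗ ρ t
    subᵗ-∘ eq (var x)    = eq x
    subᵗ-∘ eq (fun f ts) = cong (fun f) (subᵗˢ-∘ eq ts)

    subᵗˢ-∘ : ∀ {σ τ ρ : Subst} → (∀ x → subᵗ τ (σ x) ≡ ρ x) →
      ∀ {n} (ts : Vec Term n) → subᵗˢ τ (subᵗˢ σ ts) ≡ subᵗˢ ρ ts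
    subᵗˢ-∘ eq []       = refl
    subᵗˢ-∘ eq (t ∷ ts) = cong₂ _∷_ (subᵗ-∘ eq t) (subᵗˢ-∘ eq ts)

  mutual
    subᵗ-var : ∀ t → subᵗ var t ≡ t
    subᵗ-var (var x)    = refl
    subᵗ-var (fun f ts) = cong (fun f) (subᵗˢ-var ts)

    subᵗˢ-var : ∀ {n} (ts : Vec Term n) → subᵗˢ var ts ≡ ts
    subᵗˢ-var []       = refl
    subᵗˢ-var (t ∷ ts) = cong₂ _∷_ (subᵗ-var t) (subᵗˢ-var ts)

  -- By `subᵗ-∘`, both sides are the one substitution sending `x` to `subᵗ shift (τ x)`.
  lift-shift : ∀ τ t → subᵗ (lift τ) (subᵗ shift t) ≡ subᵗ shift (subᵗ τ t)
  lift-shift τ t =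
    trans (subᵗ-∘ (λ x → refl) t) (sym (subᵗ-∘ {σ = τ} {τ = shift} (λ x → refl) t))

  lift-inverse : ∀ {σ τ} → (∀ x → subᵗ τ (σ x) ≡ var x) →
    ∀ x → subᵗ (lift τ) (lift σ x) ≡ var x
  lift-inverse                 eq zero    = refl
  lift-inverse {σ = σ} {τ = τ} eq (suc x) =
    trans (lift-shift τ (σ x)) (cong (subᵗ shift) (eq x))

  -- Having a left inverse is preserved by `lift`, so the induction passes under quantifiers.
  sub-inverse : ∀ {ℓ σ τ} → (∀ x → subᵗ τ (σ x) ≡ var x) →
    ∀ (A : Formula ℓ) → sub τ (sub σ A) ≡ A
  sub-inverse eq (atom P ts) = cong (atom P) (trans (subᵗˢ-∘ eq ts) (subᵗˢ-var ts))
  sub-inverse eq 𝟏           = refl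
  sub-inverse eq ⊤           = refl
  sub-inverse eq 𝟎           = refl
  sub-inverse eq ⊥           = refl
  sub-inverse eq (A ⊗ B)     = cong₂ _⊗_ (sub-inverse eq A) (sub-inverse eq B)
  sub-inverse eq (A & B)     = cong₂ _&_ (sub-inverse eq A) (sub-inverse eq B)
  sub-inverse eq (A ⊕ B)     = cong₂ _⊕_ (sub-inverse eq A) (sub-inverse eq B)
  sub-inverse eq (A ⊸ B)     = cong₂ _⊸_ (sub-inverse eq A) (sub-inverse eq B)
  sub-inverse eq (A ⅋ B)     = cong₂ _⅋_ (sub-inverse eq A) (sub-inverse eq B)
  sub-inverse eq (∀∙ A)      = cong ∀∙_ (sub-inverse (lift-inverse eq) A)
  sub-inverse eq (∃∙ A)      = cong ∃∙_ (sub-inverse (lift-inverse eq) A)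
  sub-inverse eq (! A)       = cong !_ (sub-inverse eq A)
  sub-inverse eq (⁇ A)       = cong ⁇_ (sub-inverse eq A)

  -- Shifting a quantified formula turns its body into `sub (lift shift) A`; taking the
  -- eigenvariable as witness undoes this.
  sub-eigenvariable : ∀ {ℓ} (A : Formula ℓ) → sub (lift shift) A [ var 0 ] ≡ A
  sub-eigenvariable = sub-inverse λ { zero → refl ; (suc x) → refl }

  -- The translation adds no binders and `⊥` is closed, so each clause is a congruence. The
  -- quantifier rules need this for `A [ t ]` and `_↑`.
  ‡-sub : ∀ σ A → sub σ A ‡ ≡ sub σ (A ‡)
  ‡-sub σ (atom P ts) = refl
  ‡-sub σ 𝟏           = refl
  ‡-sub σ ⊤           = refl
  ‡-sub σ 𝟎           = refl
  ‡-sub σ ⊥           = refl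
  ‡-sub σ (A ⊗ B)     = cong₂ _⊗_ (‡-sub σ A) (‡-sub σ B)
  ‡-sub σ (A & B)     = cong₂ _&_ (‡-sub σ A) (‡-sub σ B)
  ‡-sub σ (A ⊕ B)     = cong₂ _⊕_ (‡-sub σ A) (‡-sub σ B)
  ‡-sub σ (A ⊸ B)     = cong₂ _⊸_ (‡-sub σ A) (‡-sub σ B)
  ‡-sub σ (A ⅋ B)     = cong₂ (λ X Y → ¬ (¬ X ⊗ ¬ Y)) (‡-sub σ A) (‡-sub σ B)
  ‡-sub σ (∀∙ A)      = cong ∀∙_ (‡-sub (lift σ) A)
  ‡-sub σ (∃∙ A)      = cong ∃∙_ (‡-sub (lift σ) A)
  ‡-sub σ (! A)       = cong !_ (‡-sub σ A)
  ‡-sub σ (⁇ A)       = cong (λ X → ¬ ! ¬ X) (‡-sub σ A)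

  embed : Formula intuitionistic → Formula classical
  embed (atom P ts) = atom P ts
  embed 𝟏           = 𝟏
  embed ⊤           = ⊤
  embed 𝟎           = 𝟎
  embed ⊥           = ⊥
  embed (A ⊗ B)     = embed A ⊗ embed B
  embed (A & B)     = embed A & embed B
  embed (A ⊕ B)     = embed A ⊕ embed B
  embed (A ⊸ B)     = embed A ⊸ embed B
  embed (∀∙ A)      = ∀∙ embed A
  embed (∃∙ A)      = ∃∙ embed A
  embed (! A)       = ! embed A

  embed-sub : ∀ σ A → embed (sub σ A) ≡ sub σ (embed A)
  embed-sub σ (atom P ts) = refl
  embed-sub σ 𝟏           = refl
  embed-sub σ ⊤           = refl
  embed-sub σ 𝟎           = refl
  embed-sub σ ⊥           = refl
  embed-sub σ (A ⊗ B)     = cong₂ _⊗_ (embed-sub σ A) (embed-sub σ B)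
  embed-sub σ (A & B)     = cong₂ _&_ (embed-sub σ A) (embed-sub σ B)
  embed-sub σ (A ⊕ B)     = cong₂ _⊕_ (embed-sub σ A) (embed-sub σ B)
  embed-sub σ (A ⊸ B)     = cong₂ _⊸_ (embed-sub σ A) (embed-sub σ B)
  embed-sub σ (∀∙ A)      = cong ∀∙_ (embed-sub (lift σ) A)
  embed-sub σ (∃∙ A)      = cong ∃∙_ (embed-sub (lift σ) A)
  embed-sub σ (! A)       = cong !_ (embed-sub σ A)

  -- From CLL to ILL⊥ + DNE

  module _ where
    private variable
      A B   : Formula intuitionistic
      C     : Maybe (Formula intuitionistic)
      Γ Δ   : List (Formula intuitionistic)

    ¬R : CLLb A ∷ Γ ⊢ nothing → CLLb Γ ⊢ just (¬ A)
    ¬R d = ⊸R (⊥R d)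

    ¬L : CLLb Γ ⊢ just A → CLLb ¬ A ∷ Γ ⊢ nothing
    ¬L {Γ = Γ} d = exchange (prep _ (↭.++-identityʳ Γ)) (⊸L d ⊥L)

    ¬¬-intro : CLLb A ∷ [] ⊢ just (¬ ¬ A)
    ¬¬-intro = ¬R (¬L id)

    ¬¬-elim : CLLb ¬ ¬ A ∷ [] ⊢ just A
    ¬¬-elim = axiom dne

    -- The negated formula may sit in mid-context because negated succedents will come after the
    -- translated antecedents.
    raa : ∀ Γ → CLLb Γ ++ ¬ A ∷ Δ ⊢ nothing → CLLb Γ ++ Δ ⊢ just A
    raa {A = A} {Δ = Δ} Γ d =
      exchange (↭.++-identityʳ _)
        (cut (¬R (exchange (↭.shift (¬ A) Γ Δ) d)) ¬¬-elim)

    refute : ∀ Γ → CLLb Γ ++ Δ ⊢ just A → CLLb Γ ++ ¬ A ∷ Δ ⊢ nothing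
    refute {Δ = Δ} {A = A} Γ d = exchange (↭-sym (↭.shift (¬ A) Γ Δ)) (¬L d)

    replace : CLLb A ∷ [] ⊢ just B → CLLb B ∷ Γ ⊢ C → CLLb A ∷ Γ ⊢ C
    replace = cut

    -- A formula just replaced joins the prefix `Γ`, so that the next one can be brought to the
    -- head, where `replace` acts.
    replaceAll : ∀ {X : Set} {f g : X → Formula intuitionistic} →
      (∀ x → CLLb f x ∷ [] ⊢ just (g x)) →
      ∀ Γ xs → CLLb Γ ++ map g xs ⊢ C → CLLb Γ ++ map f xs ⊢ C
    replaceAll                 f⊢g Γ []       d = d
    replaceAll {f = f} {g = g} f⊢g Γ (x ∷ xs) d =
      exchange (↭-sym (↭.shift (f x) Γ (map f xs)))
        (replaceAll f⊢g (f x ∷ Γ) xs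
          (replace (f⊢g x) (exchange (↭.shift (g x) Γ (map g xs)) d)))

  -- Intuitionistic reading of classical sequents

  module _ where
    private variable
      A   : Formula classical
      B   : Formula intuitionistic
      Γ Δ : List (Formula classical)

    ¬‡ : Formula classical → Formula intuitionistic
    ¬‡ A = ¬ A ‡

    infix 4 _∣_

    _∣_ : List (Formula classical) → List (Formula classical) → List (Formula intuitionistic)
    Γ ∣ Δ = map _‡ Γ ++ map ¬‡ Δ

    -- Multiplicative rules with two premises join antecedents and succedents separately in CLL, but
    -- whole contexts in ILL⊥; this reconciles the two.
    ∣-++ : ∀ Γ Δ Γ′ Δ′ → (Γ ∣ Δ) ++ (Γ′ ∣ Δ′) ↭ (Γ ++ Γ′ ∣ Δ ++ Δ′)
    ∣-++ Γ Δ Γ′ Δ′ = ↭-trans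
      (++-interchange (map _‡ Γ) (map ¬‡ Δ) (map _‡ Γ′) (map ¬‡ Δ′))
      (↭-reflexive (sym (cong₂ _++_ (map-++ _‡ Γ Γ′) (map-++ ¬‡ Δ Δ′))))

    ∣-↑ : ∀ Γ Δ → (map _↑ Γ ∣ map _↑ Δ) ≡ map _↑ (Γ ∣ Δ)
    ∣-↑ Γ Δ = trans
      (cong₂ _++_ (map-square (‡-sub shift) Γ) (map-square (cong ¬_ ∘ ‡-sub shift) Δ))
      (sym (map-++ _↑ (map _‡ Γ) (map ¬‡ Δ)))

    ∣-shift : ∀ A Γ → (Γ ∣ A ∷ Δ) ↭ ¬‡ A ∷ (Γ ∣ Δ)
    ∣-shift {Δ = Δ} A Γ = ↭.shift (¬‡ A) (map _‡ Γ) (map ¬‡ Δ)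

    ∣-shift₂ : ∀ A A′ Γ → (Γ ∣ A ∷ A′ ∷ Δ) ↭ ¬‡ A ∷ ¬‡ A′ ∷ (Γ ∣ Δ)
    ∣-shift₂ A A′ Γ = ↭-trans (∣-shift A Γ) (prep _ (∣-shift A′ Γ))

    -- Most right rules follow one pattern: bring the active formula to the right by DNE, apply the
    -- intuitionistic rule, and return with `toLeft`.
    toRight : ∀ Γ → CLLb Γ ∣ A ∷ Δ ⊢ nothing → CLLb Γ ∣ Δ ⊢ just (A ‡)
    toRight Γ = raa (map _‡ Γ)

    toLeft : ∀ Γ → CLLb Γ ∣ Δ ⊢ just (A ‡) → CLLb Γ ∣ A ∷ Δ ⊢ nothing
    toLeft Γ = refute (map _‡ Γ)

    -- Once each `⁇ A` on the right is read as `! ¬ A ‡` on the left, the entire context is banged,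
    -- as promotion requires.
    bang-map : ∀ Γ (Δ : List (Formula classical)) →
      map _‡ (map !_ Γ) ++ map (λ A → ! ¬‡ A) Δ ≡ map !_ (Γ ∣ Δ)
    bang-map Γ Δ = trans
      (cong₂ _++_ (map-square (λ _ → refl) Γ) (map-∘ Δ))
      (sym (map-++ !_ (map _‡ Γ) (map ¬‡ Δ)))

    -- DNE identifies ¬ (⁇ A) ‡, which is ¬ ¬ ! ¬ A ‡, with the formula
    -- ! ¬ A ‡ that promotion accepts on the left.
    promote : ∀ Γ Δ → CLLb map !_ Γ ∣ map ⁇_ Δ ⊢ just B → CLLb map !_ Γ ∣ map ⁇_ Δ ⊢ just (! B)
    promote {B = B} Γ Δ d =
      subst (λ Π → CLLb map _‡ (map !_ Γ) ++ Π ⊢ just (! B)) (map-∘ Δ)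
        (replaceAll (λ _ → ¬¬-elim) !Γ Δ
          (subst (λ Π → CLLb Π ⊢ just (! B)) (sym (bang-map Γ Δ))
            (!R
              (subst (λ Π → CLLb Π ⊢ just B) (bang-map Γ Δ)
                (replaceAll (λ _ → ¬¬-intro) !Γ Δ
                  (subst (λ Π → CLLb map _‡ (map !_ Γ) ++ Π ⊢ just B) (sym (map-∘ Δ)) d))))))
      where !Γ = map _‡ (map !_ Γ)

    CLL⇒CLLb : CLL Γ ⊢ Δ → CLLb Γ ∣ Δ ⊢ nothing
    CLL⇒CLLb (exchange p q d) = exchange (↭.++⁺ (↭.map⁺ _‡ p) (↭.map⁺ ¬‡ q)) (CLL⇒CLLb d)
    CLL⇒CLLb id = exchange (swap _ _ refl) (¬L id)
    CLL⇒CLLb (cut {Γ = Γ} {Δ = Δ} {Γ′ = Γ′} {Δ′ = Δ′} d e) =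
      exchange (∣-++ Γ Δ Γ′ Δ′) (cut (toRight Γ (CLL⇒CLLb d)) (CLL⇒CLLb e))
    CLL⇒CLLb 𝟏R = ¬L 𝟏R
    CLL⇒CLLb (𝟏L d) = 𝟏L (CLL⇒CLLb d)
    CLL⇒CLLb (⊤R {Γ = Γ}) = toLeft Γ ⊤R
    CLL⇒CLLb 𝟎L = 𝟎L
    CLL⇒CLLb ⊥L = ⊥L
    CLL⇒CLLb (⊥R {Γ = Γ} d) = toLeft Γ (⊥R (CLL⇒CLLb d))
    CLL⇒CLLb (⊗R {Γ = Γ} {Δ = Δ} {Γ′ = Γ′} {Δ′ = Δ′} d e) =
      toLeft (Γ ++ Γ′)
        (exchange (∣-++ Γ Δ Γ′ Δ′)
          (⊗R (toRight Γ (CLL⇒CLLb d)) (toRight Γ′ (CLL⇒CLLb e))))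
    CLL⇒CLLb (⊗L d) = ⊗L (CLL⇒CLLb d)
    -- `A` and `B` already stand on the left as `¬ A ‡` and `¬ B ‡`, so `⊗L` joins them into the
    -- tensor that the translated par negates.
    CLL⇒CLLb (⅋R {Γ = Γ} {A = A} {B = B} d) =
      toLeft {A = A ⅋ B} Γ
        (¬R (⊗L (exchange (∣-shift₂ A B Γ) (CLL⇒CLLb d))))
    CLL⇒CLLb (⅋L {Γ = Γ} {Δ = Δ} {Γ′ = Γ′} {Δ′ = Δ′} d e) =
      exchange (prep _ (∣-++ Γ Δ Γ′ Δ′)) (¬L (⊗R (¬R (CLL⇒CLLb d)) (¬R (CLL⇒CLLb e))))
    CLL⇒CLLb (⊸R {A = A} {Γ = Γ} {B = B} d) = toLeft {A = A ⊸ B} Γ (⊸R (toRight (A ∷ Γ) (CLL⇒CLLb d)))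
    CLL⇒CLLb (⊸L {Γ = Γ} {Δ = Δ} {Γ′ = Γ′} {Δ′ = Δ′} d e) =
      exchange (prep _ (∣-++ Γ Δ Γ′ Δ′)) (⊸L (toRight Γ (CLL⇒CLLb d)) (CLL⇒CLLb e))
    CLL⇒CLLb (&R {Γ = Γ} d e) =
      toLeft Γ (&R (toRight Γ (CLL⇒CLLb d)) (toRight Γ (CLL⇒CLLb e)))
    CLL⇒CLLb (&L₁ d) = &L₁ (CLL⇒CLLb d)
    CLL⇒CLLb (&L₂ d) = &L₂ (CLL⇒CLLb d)
    CLL⇒CLLb (⊕R₁ {Γ = Γ} d) = toLeft Γ (⊕R₁ (toRight Γ (CLL⇒CLLb d)))
    CLL⇒CLLb (⊕R₂ {Γ = Γ} d) = toLeft Γ (⊕R₂ (toRight Γ (CLL⇒CLLb d)))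
    CLL⇒CLLb (⊕L d e) = ⊕L (CLL⇒CLLb d) (CLL⇒CLLb e)
    CLL⇒CLLb (∀R {Γ = Γ} {A = A} {Δ = Δ} d) =
      toLeft Γ (∀R (subst (λ Π → CLLb Π ⊢ just (A ‡)) (∣-↑ Γ Δ)
        (toRight (map _↑ Γ) (CLL⇒CLLb d))))
    CLL⇒CLLb (∀L {A = A} {t = t} {Γ = Γ} {Δ = Δ} d) =
      ∀L (subst (λ B → CLLb B ∷ (Γ ∣ Δ) ⊢ nothing) (‡-sub (instantiate t) A) (CLL⇒CLLb d))
    CLL⇒CLLb (∃R {Γ = Γ} {A = A} {t = t} {Δ = Δ} d) =
      toLeft Γ (∃R (subst (λ B → CLLb Γ ∣ Δ ⊢ just B) (‡-sub (instantiate t) A)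
        (toRight Γ (CLL⇒CLLb d))))
    CLL⇒CLLb (∃L {A = A} {Γ = Γ} {Δ = Δ} d) =
      ∃L (subst (λ Π → CLLb A ‡ ∷ Π ⊢ nothing) (∣-↑ Γ Δ) (CLL⇒CLLb d))
    CLL⇒CLLb (!C d) = !C (CLL⇒CLLb d)
    CLL⇒CLLb (!W d) = !W (CLL⇒CLLb d)
    CLL⇒CLLb (!R {Γ = Γ} {Δ = Δ} d) =
      toLeft (map !_ Γ) (promote Γ Δ (toRight (map !_ Γ) (CLL⇒CLLb d)))
    CLL⇒CLLb (!L d) = !L (CLL⇒CLLb d)
    -- The negation of `(⁇ A) ‡` is a doubly negated `! ¬ A ‡`. Both copies are stripped of the
    -- double negation and contracted with `!C`; DNE restores it on the result. Weakening and
    -- dereliction use `!W` and `!L` in the same way.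
    CLL⇒CLLb (⁇C {Γ = Γ} {A = A} d) =
      exchange (↭-sym (∣-shift (⁇ A) Γ))
        (replace ¬¬-elim
          (!C
            (replace ¬¬-intro
              (exchange (swap _ _ refl)
                (replace ¬¬-intro
                  (exchange (∣-shift₂ (⁇ A) (⁇ A) Γ) (CLL⇒CLLb d)))))))
    CLL⇒CLLb (⁇W {Γ = Γ} {A = A} d) =
      exchange (↭-sym (∣-shift (⁇ A) Γ)) (replace ¬¬-elim (!W (CLL⇒CLLb d)))
    CLL⇒CLLb (⁇R {Γ = Γ} {A = A} d) =
      exchange (↭-sym (∣-shift (⁇ A) Γ))
        (replace ¬¬-elim (!L (exchange (∣-shift A Γ) (CLL⇒CLLb d))))
    -- The premise refutes `A ‡`, so `¬ A ‡` can be promoted; `(⁇ A) ‡` is the negation of the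
    -- result.
    CLL⇒CLLb (⁇L {Γ = Γ} {Δ = Δ} d) = ¬L (promote Γ Δ (¬R (CLL⇒CLLb d)))

  -- From ILL⊥ + DNE to CLL

  embedˢ : List (Formula intuitionistic) → List (Formula classical)
  embedˢ = map embed

  embedᵐ : Maybe (Formula intuitionistic) → List (Formula classical)
  embedᵐ C = fromMaybe (Maybe.map embed C)

  embedˢ-↑ : ∀ Γ → embedˢ (map _↑ Γ) ≡ map _↑ (embedˢ Γ)
  embedˢ-↑ = map-square (embed-sub shift)

  embedᵐ-↑ : ∀ C → embedᵐ (Maybe.map _↑ C) ≡ map _↑ (embedᵐ C)
  embedᵐ-↑ nothing  = refl
  embedᵐ-↑ (just A) = cong (_∷ []) (embed-sub shift A)

  embedˢ-! : ∀ Γ → embedˢ (map !_ Γ) ≡ map !_ (embedˢ Γ)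
  embedˢ-! = map-square (λ _ → refl)

  -- Each rule of ILL⊥ is the CLL rule of the same name with at most one formula in every succedent;
  -- only DNE needs a derivation.
  CLLb⇒CLL : ∀ {Γ C} → CLLb Γ ⊢ C → CLL embedˢ Γ ⊢ embedᵐ C
  -- The classical move is to keep `A` in the succedent while `⊸R` forms `¬ A` beside it, which
  -- gives excluded middle in its par form.
  CLLb⇒CLL (axiom dne) = ⊸L (⊸R (⊥R id)) ⊥L
  CLLb⇒CLL (exchange p d) = exchange (↭.map⁺ embed p) refl (CLLb⇒CLL d)
  CLLb⇒CLL id = id
  CLLb⇒CLL (cut {Γ = Γ} d e) =
    subst (λ Π → CLL Π ⊢ _) (sym (map-++ embed Γ _)) (cut (CLLb⇒CLL d) (CLLb⇒CLL e))
  CLLb⇒CLL 𝟏R = 𝟏R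
  CLLb⇒CLL (𝟏L d) = 𝟏L (CLLb⇒CLL d)
  CLLb⇒CLL ⊤R = ⊤R
  CLLb⇒CLL 𝟎L = 𝟎L
  CLLb⇒CLL ⊥L = ⊥L
  CLLb⇒CLL (⊥R d) = ⊥R (CLLb⇒CLL d)
  CLLb⇒CLL (⊗R {Γ = Γ} d e) =
    subst (λ Π → CLL Π ⊢ _) (sym (map-++ embed Γ _)) (⊗R (CLLb⇒CLL d) (CLLb⇒CLL e))
  CLLb⇒CLL (⊗L d) = ⊗L (CLLb⇒CLL d)
  CLLb⇒CLL (⊸R d) = ⊸R (CLLb⇒CLL d)
  CLLb⇒CLL (⊸L {Γ = Γ} d e) =
    subst (λ Π → CLL _ ∷ Π ⊢ _) (sym (map-++ embed Γ _)) (⊸L (CLLb⇒CLL d) (CLLb⇒CLL e))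
  CLLb⇒CLL (&R d e) = &R (CLLb⇒CLL d) (CLLb⇒CLL e)
  CLLb⇒CLL (&L₁ d) = &L₁ (CLLb⇒CLL d)
  CLLb⇒CLL (&L₂ d) = &L₂ (CLLb⇒CLL d)
  CLLb⇒CLL (⊕R₁ d) = ⊕R₁ (CLLb⇒CLL d)
  CLLb⇒CLL (⊕R₂ d) = ⊕R₂ (CLLb⇒CLL d)
  CLLb⇒CLL (⊕L d e) = ⊕L (CLLb⇒CLL d) (CLLb⇒CLL e)
  CLLb⇒CLL (∀R {Γ = Γ} d) = ∀R (subst (λ Π → CLL Π ⊢ _) (embedˢ-↑ Γ) (CLLb⇒CLL d))
  CLLb⇒CLL (∀L {A = A} {t = t} d) =
    ∀L (subst (λ B → CLL B ∷ _ ⊢ _) (embed-sub (instantiate t) A) (CLLb⇒CLL d))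
  CLLb⇒CLL (∃R {A = A} {t = t} d) =
    ∃R (subst (λ B → CLL _ ⊢ B ∷ []) (embed-sub (instantiate t) A) (CLLb⇒CLL d))
  CLLb⇒CLL (∃L {A = A} {Γ = Γ} {C = C} d) =
    -- The equalities are used as permutations, so that one `exchange` rewrites both sides of the
    -- sequent.
    ∃L (exchange (prep _ (↭-reflexive (embedˢ-↑ Γ))) (↭-reflexive (embedᵐ-↑ C)) (CLLb⇒CLL d))
  CLLb⇒CLL (!C d) = !C (CLLb⇒CLL d)
  CLLb⇒CLL (!W d) = !W (CLLb⇒CLL d)
  CLLb⇒CLL (!R {Γ = Γ} d) =
    subst (λ Π → CLL Π ⊢ _) (sym (embedˢ-! Γ))
      (!R {Δ = []} (subst (λ Π → CLL Π ⊢ _) (embedˢ-! Γ) (CLLb⇒CLL d)))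
  CLLb⇒CLL (!L d) = !L (CLLb⇒CLL d)

  -- Equivalence of a formula and its translation inside CLL

  module _ where
    private variable
      A B : Formula classical
      Γ Δ : List (Formula classical)

    swapL : CLL A ∷ B ∷ Γ ⊢ Δ → CLL B ∷ A ∷ Γ ⊢ Δ
    swapL = exchange (swap _ _ refl) refl

    ∀L₀ : CLL A ∷ Γ ⊢ Δ → CLL (∀∙ A) ↑ ∷ Γ ⊢ Δ
    ∀L₀ {A = A} {Γ = Γ} {Δ = Δ} d =
      ∀L (subst (λ B → CLL B ∷ Γ ⊢ Δ) (sym (sub-eigenvariable A)) d)

    ∃R₀ : CLL Γ ⊢ A ∷ Δ → CLL Γ ⊢ (∃∙ A) ↑ ∷ Δ
    ∃R₀ {Γ = Γ} {A = A} {Δ = Δ} d =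
      ∃R (subst (λ B → CLL Γ ⊢ B ∷ Δ) (sym (sub-eigenvariable A)) d)

  mutual
    -- Proved together with the converse because `⊸` is contravariant on its left, where each
    -- direction calls the other.
    ‡-elim : ∀ A → CLL embed (A ‡) ∷ [] ⊢ A ∷ []
    ‡-elim (atom P ts) = id
    ‡-elim 𝟏           = id
    ‡-elim ⊤           = id
    ‡-elim 𝟎           = id
    ‡-elim ⊥           = id
    ‡-elim (A ⊗ B)     = ⊗L (⊗R (‡-elim A) (‡-elim B))
    ‡-elim (A & B)     = &R (&L₁ (‡-elim A)) (&L₂ (‡-elim B))
    ‡-elim (A ⊕ B)     = ⊕L (⊕R₁ (‡-elim A)) (⊕R₂ (‡-elim B))
    ‡-elim (A ⊸ B)     = ⊸R (swapL (⊸L (‡-intro A) (‡-elim B)))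
    -- `⊗R` distributes the succedent formulas `A` and `B`, one to each negated factor.
    ‡-elim (A ⅋ B)     = ⅋R (⊸L (⊗R (⊸R (⊥R (‡-elim A))) (⊸R (⊥R (‡-elim B)))) ⊥L)
    ‡-elim (∀∙ A)      = ∀R (∀L₀ (‡-elim A))
    ‡-elim (∃∙ A)      = ∃L (∃R₀ (‡-elim A))
    ‡-elim (! A)       = !R {Γ = _ ∷ []} {Δ = []} (!L (‡-elim A))
    -- `!R` admits only `⁇` formulas beside its principal one, so `⁇R` is applied above it.
    ‡-elim (⁇ A)       = ⊸L (!R {Γ = []} {Δ = A ∷ []} (⊸R (⊥R (⁇R (‡-elim A))))) ⊥L

    ‡-intro : ∀ A → CLL A ∷ [] ⊢ embed (A ‡) ∷ []
    ‡-intro (atom P ts) = id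
    ‡-intro 𝟏           = id
    ‡-intro ⊤           = id
    ‡-intro 𝟎           = id
    ‡-intro ⊥           = id
    ‡-intro (A ⊗ B)     = ⊗L (⊗R (‡-intro A) (‡-intro B))
    ‡-intro (A & B)     = &R (&L₁ (‡-intro A)) (&L₂ (‡-intro B))
    ‡-intro (A ⊕ B)     = ⊕L (⊕R₁ (‡-intro A)) (⊕R₂ (‡-intro B))
    ‡-intro (A ⊸ B)     = ⊸R (swapL (⊸L (‡-elim A) (‡-intro B)))
    ‡-intro (A ⅋ B)     =
      ⊸R (⊥R (⊗L (exchange (↭-sym (↭.shift (A ⅋ B) (_ ∷ _ ∷ []) [])) refl
        (⅋L (swapL (⊸L (‡-intro A) ⊥L)) (swapL (⊸L (‡-intro B) ⊥L))))))
    ‡-intro (∀∙ A)      = ∀R (∀L₀ (‡-intro A))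
    ‡-intro (∃∙ A)      = ∃L (∃R₀ (‡-intro A))
    ‡-intro (! A)       = !R {Γ = _ ∷ []} {Δ = []} (!L (‡-intro A))
    -- `⁇L` applies because the only other formula is `! ¬ A ‡`; its dereliction therefore comes
    -- above.
    ‡-intro (⁇ A)       =
      ⊸R (⊥R (swapL (⁇L {Γ = _ ∷ []} {Δ = []} (swapL (!L (⊸L (‡-intro A) ⊥L))))))

proposition2 : (S : Signature) → let open LinearLogic S in
    (A : Formula classical) → (⊢CLL A) ⇔ (⊢CLLb A ‡)
proposition2 S A = mk⇔
  -- With no antecedents, the reading of the sequent refutes `¬ A ‡`, and DNE turns this into a
  -- proof of `A ‡`.
  (λ d → toRight [] (CLL⇒CLLb d))
  (λ d → LinearLogic.cut (CLLb⇒CLL d) (‡-elim A))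
  where open Translation S
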